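{- Let $A$ and $B$ be two $m\times m$ coloring matrices. If $A$ and $B$ are tree coloring equivalent, then $A$ and $B$ have the same number of entries equal to $1$. If $A$ and $B$ are strictly tree coloring equivalent, then for every $1\le i\le m$, row $i$ of $A$ and row $i$ of $B$ contain the same number of ones.
   Context: A plane tree is an unlabeled rooted tree in which the children of every vertex are linearly ordered (left to right). A coloring matrix is an $m\times m$ matrix $A=(a_{ij})$ with entries in $\{0,1\}$. Given $A$, an $A$-coloring of a plane tree assigns to each vertex a color in $\{1,\dots,m\}$ such that whenever a vertex of color $j$ is a child of a vertex of color $i$, we have $a_{ij}=1$. Let $t_A(n)$ be the number of pairs (plane tree with $n$ vertices, $A$-coloring of it), and $t_A^{(i)}(n)$ the number of those in which the root has color $i$. Two $m\times m$ coloring matrices $A,B$ are tree coloring equivalent if $t_A(n)=t_B(n)$ for all $n\ge1$, and strictly tree coloring equivalent if $t_A^{(i)}(n)=t_B^{(i)}(n)$ for all $n\ge1$ and all $1\le i\le m$. -}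

module Defs where

open import Data.Fin using (Fin)
open import Data.Fin.Patterns using (1F)
import Data.Fin.Properties as Fin
open import Data.List using (List; []; _∷_; length; map; filter; concatMap; allFin; cartesianProduct; cartesianProductWith)
open import Data.List.Membership.Propositional using (_∈_; find; lose)
open import Data.List.Membership.Propositional.Properties
  using (∈-allFin; ∈-cartesianProductWith⁺; ∈-cartesianProductWith⁻; ∈-concatMap⁺; ∈-concatMap⁻; ∈-filter⁺; ∈-filter⁻; ∈-map⁺; ∈-map⁻)
open import Data.List.Relation.Binary.Disjoint.Propositional using (Disjoint)
open import Data.List.Relation.Unary.All using (All; []; _∷_; tabulate; universal)
import Data.List.Relation.Unary.All.Properties as All
open import Data.List.Relation.Unary.AllPairs using ([]; _∷_)
import Data.List.Relation.Unary.AllPairs as AllPairs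
import Data.List.Relation.Unary.AllPairs.Properties as AllPairs
open import Data.List.Relation.Unary.Any using (here; there)
open import Data.List.Relation.Unary.Unique.Propositional using (Unique)
import Data.List.Relation.Unary.Unique.Propositional.Properties as Unique
open import Data.Nat using (ℕ; zero; suc; _+_; _≤_; s≤s; _≟_)
open import Data.Nat.Properties using (≤-trans; m≤m+n; m≤n+m)
open import Data.Product using (Σ; _×_; _,_; proj₁; proj₂)
open import Data.Unit using (⊤; tt)
open import Function using (_∘_; _⇔_; mk⇔; Equivalence)
open import Relation.Binary.PropositionalEquality using (_≡_; _≢_; refl)
open import Relation.Nullary using (Dec; yes)
open import Relation.Nullary.Decidable using (_×-dec_)

ColoringMatrix : ℕ → Set
ColoringMatrix m = Fin m → Fin m → Fin 2

rowOnes : ∀ {m} → ColoringMatrix m → Fin m → ℕ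
rowOnes {m} A i = length (filter (λ j → A i j Fin.≟ 1F) (allFin m))

ones : ∀ {m} → ColoringMatrix m → ℕ
ones {m} A = length (filter (λ (i , j) → A i j Fin.≟ 1F) (cartesianProduct (allFin m) (allFin m)))

data PlaneTree : Set where
  node : List PlaneTree → PlaneTree

mutual
  vertices : PlaneTree → ℕ
  vertices (node ts) = suc (forestVertices ts)

  forestVertices : List PlaneTree → ℕ
  forestVertices []       = 0
  forestVertices (t ∷ ts) = vertices t + forestVertices ts

-- An arbitrary assignment of a color to each vertex of the given tree: the
-- color of the root, together with an assignment for each child subtree.
data Coloring (m : ℕ) : PlaneTree → Set where
  color : ∀ {ts} → Fin m → All (Coloring m) ts → Coloring m (node ts)

rootColor : ∀ {m T} → Coloring m T → Fin m
rootColor (color i _) = i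

mutual
  IsAColoring : ∀ {m T} → ColoringMatrix m → Coloring m T → Set
  IsAColoring A (color i cs) = ChildrenOK A i cs

  -- i is the color of the parent of the roots of cs.
  ChildrenOK : ∀ {m ts} → ColoringMatrix m → Fin m → All (Coloring m) ts → Set
  ChildrenOK A i []       = ⊤
  ChildrenOK A i (c ∷ cs) = (A i (rootColor c) ≡ 1F × IsAColoring A c) × ChildrenOK A i cs

mutual
  isAColoring? : ∀ {m T} (A : ColoringMatrix m) (c : Coloring m T) → Dec (IsAColoring A c)
  isAColoring? A (color i cs) = childrenOK? A i cs

  childrenOK? : ∀ {m ts} (A : ColoringMatrix m) i (cs : All (Coloring m) ts) → Dec (ChildrenOK A i cs)
  childrenOK? A i []       = yes tt
  childrenOK? A i (c ∷ cs) = ((A i (rootColor c) Fin.≟ 1F) ×-dec isAColoring? A c) ×-dec childrenOK? A i cs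

ColoredTree : ℕ → Set
ColoredTree m = Σ PlaneTree (Coloring m)

-- A finite list of forests without repetition, containing every forest with
-- at most h vertices (and some larger ones); see forests-unique and
-- forests-complete.
forests : ℕ → List (List PlaneTree)
forests zero    = [] ∷ []
forests (suc h) = [] ∷ cartesianProductWith (λ f g → node f ∷ g) (forests h) (forests h)

planeTrees : ℕ → List PlaneTree
planeTrees n = filter (λ T → vertices T ≟ n) (map node (forests n))

mutual
  colorings : ∀ m T → List (Coloring m T)
  colorings m (node ts) = cartesianProductWith color (allFin m) (forestColorings m ts)

  forestColorings : ∀ m ts → List (All (Coloring m) ts)
  forestColorings m []       = [] ∷ []
  forestColorings m (t ∷ ts) = cartesianProductWith _∷_ (colorings m t) (forestColorings m ts)

-- All pairs of a plane tree with n vertices and an A-coloring of it, each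
-- listed exactly once: see ∈-coloredTrees and coloredTrees-unique.
coloredTrees : ∀ {m} → ColoringMatrix m → ℕ → List (ColoredTree m)
coloredTrees {m} A n =
  filter (λ (T , c) → isAColoring? A c)
         (concatMap (λ T → map (T ,_) (colorings m T)) (planeTrees n))

t : ∀ {m} → ColoringMatrix m → ℕ → ℕ
t A n = length (coloredTrees A n)

tᵣ : ∀ {m} → ColoringMatrix m → Fin m → ℕ → ℕ
tᵣ A i n = length (filter (λ (T , c) → rootColor c Fin.≟ i) (coloredTrees A n))

TreeColoringEquivalent : ∀ {m} → ColoringMatrix m → ColoringMatrix m → Set
TreeColoringEquivalent A B = ∀ n → 1 ≤ n → t A n ≡ t B n

StrictlyTreeColoringEquivalent : ∀ {m} → ColoringMatrix m → ColoringMatrix m → Set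
StrictlyTreeColoringEquivalent A B = ∀ n → 1 ≤ n → ∀ i → tᵣ A i n ≡ tᵣ B i n

forests-complete : ∀ h ts → forestVertices ts ≤ h → ts ∈ forests h
forests-complete zero    []             _       = here refl
forests-complete zero    (node _ ∷ _)   ()
forests-complete (suc h) []             _       = here refl
forests-complete (suc h) (node f ∷ ts) (s≤s p) = there
  (∈-cartesianProductWith⁺ (λ f g → node f ∷ g)
    (forests-complete h f  (≤-trans (m≤m+n _ _) p))
    (forests-complete h ts (≤-trans (m≤n+m _ (forestVertices f)) p)))

forests-unique : ∀ h → Unique (forests h)
forests-unique zero    = [] ∷ []
forests-unique (suc h) =
  tabulate nonempty ∷
  Unique.cartesianProductWith⁺ _ (λ { refl → refl , refl }) (forests-unique h) (forests-unique h)
  where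
  nonempty : ∀ {ts} → ts ∈ cartesianProductWith (λ f g → node f ∷ g) (forests h) (forests h) → [] ≢ ts
  nonempty p with ∈-cartesianProductWith⁻ (λ f g → node f ∷ g) (forests h) (forests h) p
  ... | _ , _ , _ , _ , refl = λ ()

∈-planeTrees : ∀ {n T} → T ∈ planeTrees n ⇔ vertices T ≡ n
∈-planeTrees {n} = mk⇔ (proj₂ ∘ ∈-filter⁻ (λ T → vertices T ≟ n) {xs = map node (forests n)}) complete
  where
  complete : ∀ {T} → vertices T ≡ n → T ∈ planeTrees n
  complete {node ts} refl = ∈-filter⁺ (λ T → vertices T ≟ n)
    (∈-map⁺ node (forests-complete n ts (m≤n+m _ 1))) refl

planeTrees-unique : ∀ n → Unique (planeTrees n)
planeTrees-unique n = Unique.filter⁺ (λ T → vertices T ≟ n)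
  (Unique.map⁺ (λ { refl → refl }) (forests-unique n))

mutual
  colorings-complete : ∀ {m T} (c : Coloring m T) → c ∈ colorings m T
  colorings-complete (color i cs) = ∈-cartesianProductWith⁺ color (∈-allFin i) (forestColorings-complete cs)

  forestColorings-complete : ∀ {m ts} (cs : All (Coloring m) ts) → cs ∈ forestColorings m ts
  forestColorings-complete []       = here refl
  forestColorings-complete (c ∷ cs) = ∈-cartesianProductWith⁺ _∷_ (colorings-complete c) (forestColorings-complete cs)

mutual
  colorings-unique : ∀ m T → Unique (colorings m T)
  colorings-unique m (node ts) = Unique.cartesianProductWith⁺ color
    (λ { refl → refl , refl }) (Unique.allFin⁺ m) (forestColorings-unique m ts)

  forestColorings-unique : ∀ m ts → Unique (forestColorings m ts)
  forestColorings-unique m []       = [] ∷ []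
  forestColorings-unique m (t ∷ ts) = Unique.cartesianProductWith⁺ _∷_
    (λ { refl → refl , refl }) (colorings-unique m t) (forestColorings-unique m ts)

∈-coloredTrees : ∀ {m} {A : ColoringMatrix m} {n T} {c : Coloring m T} →
                 (T , c) ∈ coloredTrees A n ⇔ (vertices T ≡ n × IsAColoring A c)
∈-coloredTrees {m} {A} {n} = mk⇔ sound complete
  where
  fibre : PlaneTree → List (ColoredTree m)
  fibre T = map (T ,_) (colorings m T)

  ok? : (x : ColoredTree m) → Dec (IsAColoring A (proj₂ x))
  ok? (T , c) = isAColoring? A c

  tree : ∀ {x T} → x ∈ fibre T → proj₁ x ≡ T
  tree p with ∈-map⁻ _ p
  ... | _ , _ , refl = refl

  sound : ∀ {T} {c : Coloring m T} → (T , c) ∈ coloredTrees A n → vertices T ≡ n × IsAColoring A c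
  sound p with ∈-filter⁻ ok? {xs = concatMap fibre (planeTrees n)} p
  ... | q , ok with find (∈-concatMap⁻ fibre {xs = planeTrees n} q)
  ... | T′ , T′∈ , r with tree r
  ... | refl = Equivalence.to ∈-planeTrees T′∈ , ok

  complete : ∀ {T} {c : Coloring m T} → vertices T ≡ n × IsAColoring A c → (T , c) ∈ coloredTrees A n
  complete {T} {c} (v , ok) = ∈-filter⁺ ok?
    (∈-concatMap⁺ fibre (lose (Equivalence.from ∈-planeTrees v) (∈-map⁺ (T ,_) (colorings-complete c)))) ok

coloredTrees-unique : ∀ {m} (A : ColoringMatrix m) n → Unique (coloredTrees A n)
coloredTrees-unique {m} A n = Unique.filter⁺ (λ (T , c) → isAColoring? A c)
  (Unique.concat⁺
    (All.map⁺ (universal (λ T → Unique.map⁺ (λ { refl → refl }) (colorings-unique m T)) (planeTrees n)))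
    (AllPairs.map⁺ (AllPairs.map disjoint (planeTrees-unique n))))
  where
  disjoint : ∀ {T T′} → T ≢ T′ → Disjoint (map (T ,_) (colorings m T)) (map (T′ ,_) (colorings m T′))
  disjoint T≢T′ (p , q) with ∈-map⁻ _ p | ∈-map⁻ _ q
  ... | _ , _ , refl | _ , _ , refl = T≢T′ refl

{-# OPTIONS --safe #-}
-- The only plane tree with two vertices is a single edge, and coloring its root i
-- and its leaf j is an A-coloring exactly when a_ij = 1.  Hence t_A(2) is the number
-- of ones of A, and t_A^(i)(2) is the number of ones of row i.
module Submission where

open import Defs
open import Data.Fin using (Fin)
open import Data.Fin.Patterns using (1F)
import Data.Fin.Properties as Fin
open import Data.List using ([]; _∷_; length; map; filter; allFin; cartesianProduct)
open import Data.List.Membership.Propositional using (_∈_)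
open import Data.List.Membership.Propositional.Properties
  using (∈-allFin; ∈-cartesianProduct⁺; ∈-filter⁺; ∈-filter⁻; ∈-map⁺; ∈-map⁻)
open import Data.List.Membership.Propositional.Properties.WithK using (unique∧set⇒bag)
open import Data.List.Properties using (length-map)
open import Data.List.Relation.Binary.BagAndSetEquality using (∼bag⇒↭)
open import Data.List.Relation.Binary.Permutation.Propositional.Properties using (↭-length)
open import Data.List.Relation.Unary.All using ([]; _∷_)
open import Data.List.Relation.Unary.Unique.Propositional using (Unique)
import Data.List.Relation.Unary.Unique.Propositional.Properties as Unique
open import Data.Nat using (ℕ; z≤n; s≤s)
open import Data.Product using (∃; ∃₂; _×_; _,_)
open import Data.Unit using (tt)
open import Function using (mk⇔; Equivalence; Injective)
open import Relation.Binary.PropositionalEquality using (_≡_; refl; sym; trans; module ≡-Reasoning)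
open import Relation.Nullary using (Dec)

-- Injectivity keeps `map f xs` free of repetitions, and two repetition-free lists with the same
-- members are permutations of each other. Colored trees can thus be counted from membership alone,
-- whatever the order of enumeration.
length-bijection : ∀ {X Y : Set} {f : X → Y} {xs ys} → Injective _≡_ _≡_ f →
  Unique xs → Unique ys →
  (∀ {x} → x ∈ xs → f x ∈ ys) →
  (∀ {y} → y ∈ ys → ∃ λ x → x ∈ xs × y ≡ f x) →
  length ys ≡ length xs
length-bijection {f = f} {xs} {ys} f-inj xs! ys! into onto = begin
  length ys           ≡⟨ ↭-length (∼bag⇒↭ (unique∧set⇒bag ys! (Unique.map⁺ f-inj xs!) (mk⇔ to from))) ⟩
  length (map f xs)   ≡⟨ length-map f xs ⟩
  length xs           ∎
  where
  open ≡-Reasoning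

  to : ∀ {y} → y ∈ ys → y ∈ map f xs
  to y∈ with onto y∈
  ... | _ , x∈ , refl = ∈-map⁺ f x∈

  from : ∀ {y} → y ∈ map f xs → y ∈ ys
  from y∈ with ∈-map⁻ f y∈
  ... | _ , x∈ , refl = into x∈

module _ {m : ℕ} where

  edge : Fin m → Fin m → ColoredTree m
  edge i j = node (node [] ∷ []) , color i (color j [] ∷ [])

  two-vertices⇒edge : ∀ {T} (c : Coloring m T) → vertices T ≡ 2 → ∃₂ λ i j → (T , c) ≡ edge i j
  two-vertices⇒edge (color i (color j [] ∷ [])) _ = i , j , refl
  two-vertices⇒edge (color _ []) ()
  -- A second child or a grandchild forces a third vertex. The first child is split as well, so that
  -- the sum exposes three `suc`s.
  two-vertices⇒edge (color _ (color _ [] ∷ color _ _ ∷ _)) ()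
  two-vertices⇒edge (color _ (color _ (color _ _ ∷ _) ∷ _)) ()

  module _ (A : ColoringMatrix m) where

    entry? : ((i , j) : Fin m × Fin m) → Dec (A i j ≡ 1F)
    entry? (i , j) = A i j Fin.≟ 1F

    edge∈coloredTrees : ∀ {i j} → A i j ≡ 1F → edge i j ∈ coloredTrees A 2
    -- The first `tt` says that the leaf has no children to check, the second that the root has no
    -- further child.
    edge∈coloredTrees a≡1 = Equivalence.from (∈-coloredTrees {A = A}) (refl , (a≡1 , tt) , tt)

    coloredTrees-edge : ∀ {x} → x ∈ coloredTrees A 2 → ∃₂ λ i j → A i j ≡ 1F × x ≡ edge i j
    coloredTrees-edge {_ , c} x∈ with Equivalence.to (∈-coloredTrees {A = A}) x∈
    ... | v≡2 , ok with two-vertices⇒edge c v≡2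
    -- Only once the tree is known to be an edge does `IsAColoring` unfold, so its proof is split
    -- here.
    coloredTrees-edge x∈ | _ , (a≡1 , _) , _ | i , j , refl = i , j , a≡1 , refl

    t₂≡ones : t A 2 ≡ ones A
    t₂≡ones = length-bijection {f = λ (i , j) → edge i j} (λ { refl → refl })
      (Unique.filter⁺ entry? (Unique.cartesianProduct⁺ (Unique.allFin⁺ m) (Unique.allFin⁺ m)))
      (coloredTrees-unique A 2) into onto
      where
      into : ∀ {(i , j) : Fin m × Fin m} →
             (i , j) ∈ filter entry? (cartesianProduct (allFin m) (allFin m)) → edge i j ∈ coloredTrees A 2
      into ij∈ with ∈-filter⁻ entry? {xs = cartesianProduct (allFin m) (allFin m)} ij∈
      ... | _ , a≡1 = edge∈coloredTrees a≡1

      onto : ∀ {x} → x ∈ coloredTrees A 2 →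
             ∃ λ (i , j) → (i , j) ∈ filter entry? (cartesianProduct (allFin m) (allFin m)) × x ≡ edge i j
      onto x∈ with coloredTrees-edge x∈
      ... | i , j , a≡1 , refl =
        (i , j) , ∈-filter⁺ entry? (∈-cartesianProduct⁺ (∈-allFin i) (∈-allFin j)) a≡1 , refl

    module _ (i : Fin m) where

      root? : ((_ , c) : ColoredTree m) → Dec (rootColor c ≡ i)
      root? (_ , c) = rootColor c Fin.≟ i

      rowEntry? : ∀ j → Dec (A i j ≡ 1F)
      rowEntry? j = entry? (i , j)

      -- With the root color fixed, the leaf color alone determines a colored edge, so the bijection
      -- is `edge i`.
      tᵣ₂≡rowOnes : tᵣ A i 2 ≡ rowOnes A i
      tᵣ₂≡rowOnes = length-bijection {f = edge i} (λ { refl → refl })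
        (Unique.filter⁺ rowEntry? (Unique.allFin⁺ m))
        (Unique.filter⁺ root? (coloredTrees-unique A 2)) into onto
        where
        into : ∀ {j} → j ∈ filter rowEntry? (allFin m) → edge i j ∈ filter root? (coloredTrees A 2)
        into j∈ with ∈-filter⁻ rowEntry? {xs = allFin m} j∈
        ... | _ , a≡1 = ∈-filter⁺ root? (edge∈coloredTrees a≡1) refl

        onto : ∀ {x} → x ∈ filter root? (coloredTrees A 2) →
               ∃ λ j → j ∈ filter rowEntry? (allFin m) × x ≡ edge i j
        onto x∈ with ∈-filter⁻ root? {xs = coloredTrees A 2} x∈
        ... | x∈′ , root≡i with coloredTrees-edge x∈′
        -- With the edge exposed, `root≡i` compares its root color directly with `i`; matching it
        -- with `refl` moves `a≡1` to row `i`.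
        onto x∈ | _ , refl | _ , j , a≡1 , refl = j , ∈-filter⁺ rowEntry? (∈-allFin j) a≡1 , refl

theorem10 : (m : ℕ) (A B : ColoringMatrix m) →
    (TreeColoringEquivalent A B → ones A ≡ ones B) ×
    (StrictlyTreeColoringEquivalent A B → ∀ i → rowOnes A i ≡ rowOnes B i)
theorem10 m A B =
  (λ A∼B → trans (sym (t₂≡ones A)) (trans (A∼B 2 1≤2) (t₂≡ones B))) ,
  (λ A∼B i → trans (sym (tᵣ₂≡rowOnes A i)) (trans (A∼B 2 1≤2 i) (tᵣ₂≡rowOnes B i)))
  where
  1≤2 = s≤s z≤n
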